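{- Let $d\ge 1$ be a natural number and let $A$ and $B$ be subsets of $\mathbb{Z}^{d}$ such that $\underline{\operatorname{d}}(A)=\alpha>0$ and $\operatorname{BD}(B)>0$. Then for any real $\epsilon$ with $0<\epsilon<\alpha$, the set $A+B$ is lower syndetic of level $\alpha-\epsilon$.
   Context: Intervals denote intervals of integers, $\mathbb{N}$ does not contain $0$, and $A+B=\{a+b:a\in A,b\in B\}$. For $A\subseteq\mathbb{Z}^d$, the lower (asymptotic) density is $\underline{\operatorname{d}}(A)=\liminf_{n\to\infty}\frac{|A\cap[-n,n]^d|}{(2n+1)^d}$, and the (upper) Banach density is $\operatorname{BD}(A)=\lim_{n\to\infty}\sup_{x\in\mathbb{Z}^d}\frac{|A\cap(x+[-n,n]^d)|}{(2n+1)^d}$. For a real number $0<\alpha\le 1$, a set $C\subseteq\mathbb{Z}^d$ is lower syndetic of level $\alpha$ if there exists a natural number $m$ (with $m=0$ allowed) such that for all $k\in\mathbb{N}$, $\underline{\operatorname{d}}(\{z\in\mathbb{Z}^d: z+[-k,k]^d\subseteq C+[-m,m]^d\})\ge\alpha$. -}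

module Defs where

open import Level using (0ℓ)
open import Axiom.ExcludedMiddle using (ExcludedMiddle)
open import Data.Nat as ℕ using (ℕ; suc)
import Data.Nat.Properties as ℕ
open import Data.Integer as ℤ using (ℤ; +_)
import Data.Integer.Properties as ℤ
open import Data.Rational as ℚ using (ℚ; 0ℚ; 1ℚ)
import Data.Rational.Properties as ℚ
import Data.Rational.Unnormalised as ℚᵘ
import Data.Rational.Unnormalised.Properties as ℚᵘ
open import Data.List as List using (List; []; _∷_; length; filter; upTo; cartesianProductWith)
import Data.List.Properties as List
import Data.List.Membership.Propositional as Mem
open import Data.Vec as Vec using (Vec; zipWith)
open import Data.Product using (∃-syntax; _×_; _,_)
open import Relation.Binary.Definitions using (tri<; tri≈; tri>)
open import Relation.Binary.PropositionalEquality
  using (_≡_; refl; sym; trans; cong₂; subst; subst₂)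
open import Relation.Nullary using (contradiction)
open import Relation.Unary using (Pred; _∈_; _∉_; _⊆_)

------------------------------------------------------------------------
-- Real numbers, as the (open, one-sided) lower Dedekind cuts of ℚ.  A cut
-- need not be located, so these are the classical real numbers only in the
-- presence of excluded middle.

record ℝ : Set₁ where
  field
    cut       : Pred ℚ 0ℓ
    inhabited : ∃[ q ] q ∈ cut
    bounded   : ∃[ q ] q ∉ cut
    lower     : ∀ {p q} → p ℚ.< q → q ∈ cut → p ∈ cut
    open-up   : ∀ {q} → q ∈ cut → ∃[ r ] (q ℚ.< r × r ∈ cut)

open ℝ public

infix 4 _≤ʳ_ _<ʳ_ _≃ʳ_

_≤ʳ_ _<ʳ_ _≃ʳ_ : ℝ → ℝ → Set
x ≤ʳ y = cut x ⊆ cut y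
x <ʳ y = ∃[ q ] (q ∈ cut y × q ∉ cut x)
x ≃ʳ y = x ≤ʳ y × y ≤ʳ x

private
  p-1<p : ∀ p → p ℚ.- 1ℚ ℚ.< p
  p-1<p p = subst (p ℚ.- 1ℚ ℚ.<_) (ℚ.+-identityʳ p)
              (ℚ.+-monoʳ-< p (ℚ.negative⁻¹ (ℚ.- 1ℚ)))

  p<p+1 : ∀ p → p ℚ.< p ℚ.+ 1ℚ
  p<p+1 p = subst (ℚ._< p ℚ.+ 1ℚ) (ℚ.+-identityʳ p)
              (ℚ.+-monoʳ-< p (ℚ.positive⁻¹ 1ℚ))

∈∉⇒< : ∀ (x : ℝ) {p q} → p ∈ cut x → q ∉ cut x → p ℚ.< q
∈∉⇒< x {p} {q} p∈ q∉ with ℚ.<-cmp p q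
... | tri< p<q _ _  = p<q
... | tri≈ _ refl _ = contradiction p∈ q∉
... | tri> _ _ q<p  = contradiction (lower x q<p p∈) q∉

fromℚ : ℚ → ℝ
fromℚ p = record
  { cut       = ℚ._< p
  ; inhabited = p ℚ.- 1ℚ , p-1<p p
  ; bounded   = p , ℚ.<-irrefl refl
  ; lower     = ℚ.<-trans
  ; open-up   = λ q<p → let r , q<r , r<p = ℚ.<-dense q<p in r , q<r , r<p
  }

0ʳ 1ʳ : ℝ
0ʳ = fromℚ 0ℚ
1ʳ = fromℚ 1ℚ

infixl 6 _-ʳ_

_-ʳ_ : ℝ → ℝ → ℝ
x -ʳ y = record
  { cut       = λ q → ∃[ a ] ∃[ b ] (a ∈ cut x × b ∉ cut y × q ℚ.< a ℚ.- b)
  ; inhabited = let a , a∈ = inhabited x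
                    b , b∉ = bounded y
                in (a ℚ.- b) ℚ.- 1ℚ , a , b , a∈ , b∉ , p-1<p (a ℚ.- b)
  ; bounded   = let u , u∉ = bounded x
                    l , l∈ = inhabited y
                in u ℚ.- l , λ (a , b , a∈ , b∉ , u-l<a-b) →
                     ℚ.<-asym u-l<a-b
                       (ℚ.+-mono-< (∈∉⇒< x a∈ u∉)
                                   (ℚ.neg-antimono-< (∈∉⇒< y l∈ b∉)))
  ; lower     = λ p<q (a , b , a∈ , b∉ , q<) → a , b , a∈ , b∉ , ℚ.<-trans p<q q<
  ; open-up   = λ (a , b , a∈ , b∉ , q<) →
                  let r , q<r , r< = ℚ.<-dense q<
                  in r , q<r , a , b , a∈ , b∉ , r<
  }

-- Suprema and infima of nonempty families.  The last two arguments (a witness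
-- that the index type is nonempty, and a rational bound) do not affect the
-- value.

supʳ : {I : Set} (s : I → ℝ) → I → ∃[ hi ] (∀ i → s i ≤ʳ fromℚ hi) → ℝ
supʳ s i₀ (hi , s≤hi) = record
  { cut       = λ q → ∃[ i ] q ∈ cut (s i)
  ; inhabited = let q , q∈ = inhabited (s i₀) in q , i₀ , q∈
  ; bounded   = hi , λ (i , hi∈) → ℚ.<-irrefl refl (s≤hi i hi∈)
  ; lower     = λ p<q (i , q∈) → i , lower (s i) p<q q∈
  ; open-up   = λ (i , q∈) → let r , q<r , r∈ = open-up (s i) q∈ in r , q<r , i , r∈
  }

-- The intersection of the cuts need not be open, hence the r.
infʳ : {I : Set} (s : I → ℝ) → I → ∃[ lo ] (∀ i → fromℚ lo ≤ʳ s i) → ℝ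
infʳ s i₀ (lo , lo≤s) = record
  { cut       = λ q → ∃[ r ] (q ℚ.< r × (∀ i → r ∈ cut (s i)))
  ; inhabited = (lo ℚ.- 1ℚ) ℚ.- 1ℚ , lo ℚ.- 1ℚ , p-1<p (lo ℚ.- 1ℚ)
              , λ i → lo≤s i (p-1<p lo)
  ; bounded   = let u , u∉ = bounded (s i₀)
                in u , λ (r , u<r , r∈) → u∉ (lower (s i₀) u<r (r∈ i₀))
  ; lower     = λ p<q (r , q<r , r∈) → r , ℚ.<-trans p<q q<r , r∈
  ; open-up   = λ (r , q<r , r∈) →
                  let t , q<t , t<r = ℚ.<-dense q<r in t , q<t , r , t<r , r∈
  }

liminf : (s : ℕ → ℝ) →
         ∃[ lo ] (∀ n → fromℚ lo ≤ʳ s n) → ∃[ hi ] (∀ n → s n ≤ʳ fromℚ hi) → ℝ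
liminf s (lo , lo≤s) (hi , s≤hi) = supʳ tailInf 0 (hi , tailInf≤hi)
  where
  tailInf : ℕ → ℝ
  tailInf N = infʳ (λ n → s (N ℕ.+ n)) 0 (lo , λ n → lo≤s (N ℕ.+ n))

  tailInf≤hi : ∀ N → tailInf N ≤ʳ fromℚ hi
  tailInf≤hi N (r , q<r , r∈) = ℚ.<-trans q<r (s≤hi (N ℕ.+ 0) (r∈ 0))

_⟶_ : (ℕ → ℝ) → ℝ → Set₁
s ⟶ x = ∀ (ε : ℝ) → 0ʳ <ʳ ε →
  ∃[ N ] (∀ n → N ℕ.≤ n → (s n -ʳ x <ʳ ε) × (x -ʳ s n <ʳ ε))

------------------------------------------------------------------------
-- Subsets of ℤ^d

Subset : ℕ → Set₁
Subset d = Pred (Vec ℤ d) 0ℓ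

infixl 6 _+ᵛ_ _⊕_

_+ᵛ_ : ∀ {d} → Vec ℤ d → Vec ℤ d → Vec ℤ d
_+ᵛ_ = zipWith ℤ._+_

_⊕_ : ∀ {d} → Subset d → Subset d → Subset d
(A ⊕ B) z = ∃[ a ] ∃[ b ] (a ∈ A × b ∈ B × z ≡ a +ᵛ b)

-- [-n,n] and [-n,n]^d, each listed without repetition.
interval : ℕ → List ℤ
interval n = List.map (λ i → + i ℤ.- + n) (upTo (suc (2 ℕ.* n)))

cubeList : ∀ d → ℕ → List (Vec ℤ d)
cubeList ℕ.zero  n = Vec.[] ∷ []
cubeList (suc d) n = cartesianProductWith Vec._∷_ (interval n) (cubeList d n)

Cube : ∀ {d} → ℕ → Subset d
Cube {d} n z = z Mem.∈ cubeList d n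

private
  length-× : ∀ {a b c} {A : Set a} {B : Set b} {C : Set c} (f : A → B → C) xs ys →
             length (cartesianProductWith f xs ys) ≡ length xs ℕ.* length ys
  length-× f []       ys = refl
  length-× f (x ∷ xs) ys =
    trans (List.length-++ (List.map (f x) ys))
          (cong₂ ℕ._+_ (List.length-map (f x) ys) (length-× f xs ys))

length-cubeList : ∀ d n → length (cubeList d n) ≡ suc (2 ℕ.* n) ℕ.^ d
length-cubeList ℕ.zero  n = refl
length-cubeList (suc d) n =
  trans (length-× Vec._∷_ (interval n) (cubeList d n))
        (cong₂ ℕ._*_
          (trans (List.length-map (λ i → + i ℤ.- + n) (upTo (suc (2 ℕ.* n))))
                 (List.length-upTo (suc (2 ℕ.* n))))
          (length-cubeList d n))

-- Subsets are arbitrary predicates, so excluded middle is needed for their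
-- intersections with finite sets to have a cardinality.
module _ (em : ExcludedMiddle 0ℓ) where

  -- |A ∩ (x + [-n,n]^d)|
  count : ∀ {d} → Subset d → Vec ℤ d → ℕ → ℕ
  count {d} A x n = length (filter (λ z → em {z ∈ A}) (List.map (x +ᵛ_) (cubeList d n)))

  localDensity : ∀ {d} → Subset d → Vec ℤ d → ℕ → ℚ
  localDensity {d} A x n =
    ℚ._/_ (+ count A x n) (suc (2 ℕ.* n) ℕ.^ d) ⦃ ℕ.m^n≢0 (suc (2 ℕ.* n)) d ⦄

  private
    count≤ : ∀ {d} (A : Subset d) x n → count A x n ℕ.≤ suc (2 ℕ.* n) ℕ.^ d
    count≤ {d} A x n = begin
      count A x n                               ≤⟨ List.length-filter (λ z → em {z ∈ A}) (List.map (x +ᵛ_) (cubeList d n)) ⟩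
      length (List.map (x +ᵛ_) (cubeList d n))  ≡⟨ List.length-map (x +ᵛ_) (cubeList d n) ⟩
      length (cubeList d n)                     ≡⟨ length-cubeList d n ⟩
      suc (2 ℕ.* n) ℕ.^ d                       ∎
      where open ℕ.≤-Reasoning

    m≤n⇒m/n≤1 : ∀ m n .⦃ _ : ℕ.NonZero n ⦄ → m ℕ.≤ n → (+ m) ℚ./ n ℚ.≤ 1ℚ
    m≤n⇒m/n≤1 m (suc k) m≤n = ℚ.toℚᵘ-cancel-≤
      (ℚᵘ.≤-respˡ-≃ (ℚᵘ.≃-sym (ℚ.toℚᵘ-fromℚᵘ (ℚᵘ.mkℚᵘ (+ m) k)))
        (ℚᵘ.*≤* (subst₂ ℤ._≤_ (sym (ℤ.*-identityʳ (+ m))) (sym (ℤ.*-identityˡ (+ suc k)))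
                   (ℤ.+≤+ m≤n))))

  0≤localDensity : ∀ {d} (A : Subset d) x n → 0ℚ ℚ.≤ localDensity A x n
  0≤localDensity {d} A x n =
    ℚ.nonNegative⁻¹ _ ⦃ ℚ.normalize-nonNeg (count A x n) (suc (2 ℕ.* n) ℕ.^ d) ⦃ ℕ.m^n≢0 (suc (2 ℕ.* n)) d ⦄ ⦄

  localDensity≤1 : ∀ {d} (A : Subset d) x n → localDensity A x n ℚ.≤ 1ℚ
  localDensity≤1 {d} A x n =
    m≤n⇒m/n≤1 (count A x n) _ ⦃ ℕ.m^n≢0 (suc (2 ℕ.* n)) d ⦄ (count≤ A x n)

  lowerDensity : ∀ {d} → Subset d → ℝ
  lowerDensity {d} A = liminf (λ n → fromℚ (localDensity A (Vec.replicate d (+ 0)) n))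
    (0ℚ , λ n q<0 → ℚ.<-≤-trans q<0 (0≤localDensity A _ n))
    (1ℚ , λ n q<δ → ℚ.<-≤-trans q<δ (localDensity≤1 A _ n))

  supDensity : ∀ {d} → Subset d → ℕ → ℝ
  supDensity {d} A n = supʳ (λ x → fromℚ (localDensity A x n)) (Vec.replicate d (+ 0))
    (1ℚ , λ x q<δ → ℚ.<-≤-trans q<δ (localDensity≤1 A x n))

  -- BD(A) = β, with the limit stated as a relation: β is then unique, and it
  -- exists for every A.
  IsBanachDensity : ∀ {d} → Subset d → ℝ → Set₁
  IsBanachDensity A β = supDensity A ⟶ β

  -- The range 0 < α ≤ 1 of admissible levels is part of the definition.
  LowerSyndetic : ∀ {d} → ℝ → Subset d → Set
  LowerSyndetic {d} α C = 0ʳ <ʳ α × α ≤ʳ 1ʳ ×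
    ∃[ m ] (∀ k → 1 ℕ.≤ k →
      α ≤ʳ lowerDensity {d} (λ z → ∀ u → u ∈ Cube k → z +ᵛ u ∈ C ⊕ Cube m))

{-# OPTIONS --safe #-}

-- Let i/K be the greatest density in a fine grid that B attains on arbitrarily large cubes; then
-- all cubes of some size M have density at most (i+1)/K.  Averaging over the subcubes of size M
-- of a large cube of density i/K shows that almost all of them meet B, so B + [-M,M]^d has density
-- at least 1 - 1/D on arbitrarily large cubes b + [-L,L]^d.  If the density of A around x at a
-- scale slightly less than L exceeds about 1/D, then by pigeonhole A + B + [-M,M]^d contains
-- x + b + [-k,k]^d, where M depends only on D while L and b may depend on k.  As local densities
-- are at most 1 and average to the density of A, such x have lower density at least α - 3/D.

module Submission where

open import Defs
open import Level using (0ℓ)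
open import Axiom.ExcludedMiddle using (ExcludedMiddle)
import Algebra.Properties.AbelianGroup
import Algebra.Properties.CommutativeSemigroup
open import Data.Nat as ℕ using (ℕ; zero; suc; _≤_; z≤n; s≤s; _*_)
import Data.Nat.Properties as ℕ
open import Data.Nat.ListAction using (sum)
import Data.Nat.Tactic.RingSolver as ℕ-Solver
open import Data.Integer as ℤ using (ℤ; +_; -[1+_])
import Data.Integer.Properties as ℤ
import Data.Integer.Tactic.RingSolver as ℤ-Solver
open import Data.Rational as ℚ using (ℚ; 0ℚ; 1ℚ)
import Data.Rational.Properties as ℚ
import Data.Rational.Unnormalised as ℚᵘ
import Data.Rational.Unnormalised.Properties as ℚᵘ
open import Data.List using (List; []; _∷_; _++_; [_]; length; map; filter)
import Data.List.Properties as List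
open import Data.List.Membership.Propositional using () renaming (_∈_ to _∈ᴸ_)
import Data.List.Membership.Propositional.Properties as Mem
open import Data.List.Relation.Unary.Any using (here; there)
open import Data.List.Relation.Unary.All as All using ([]; _∷_)
open import Data.List.Relation.Unary.AllPairs using ([]; _∷_)
open import Data.List.Relation.Unary.Unique.Propositional using (Unique)
import Data.List.Relation.Unary.Unique.Propositional.Properties as Unique
open import Data.Vec as Vec using (Vec; []; _∷_)
import Data.Vec.Properties as Vec
open import Data.Product using (∃-syntax; _×_; _,_)
open import Data.Sum using (_⊎_; inj₁; inj₂)
open import Function using (_∘_; id)
open import Relation.Binary.PropositionalEquality
  using (_≡_; refl; sym; trans; cong; cong₂; subst; subst₂)
open import Relation.Nullary using (¬_; yes; no; contradiction)
open import Relation.Nullary.Decidable using (decidable-stable)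
open import Relation.Unary using (_∈_; _∉_; ∁)

private
  module ℤ-AbelianGroup = Algebra.Properties.AbelianGroup ℤ.+-0-abelianGroup
  module ℕ-+ = Algebra.Properties.CommutativeSemigroup ℕ.+-commutativeSemigroup
  module ℕ-* = Algebra.Properties.CommutativeSemigroup ℕ.*-commutativeSemigroup

-- Lengths and finite sums over lists.

unique-⊆⇒length≤ : {A : Set} {xs ys : List A} → Unique xs →
  (∀ {z} → z ∈ᴸ xs → z ∈ᴸ ys) → length xs ≤ length ys
unique-⊆⇒length≤ {xs = []} _ _ = z≤n
-- Delete one occurrence of `x` from `ys`; the tail still embeds in what remains, because `x` does
-- not recur in it.
unique-⊆⇒length≤ {xs = x ∷ xs} (x∉ ∷ u) sub with Mem.∈-∃++ (sub (here refl))
... | as , bs , refl = begin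
  suc (length xs)                ≤⟨ s≤s (unique-⊆⇒length≤ u sub′) ⟩
  suc (length (as ++ bs))        ≡⟨ cong suc (List.length-++ as) ⟩
  suc (length as ℕ.+ length bs)  ≡⟨ ℕ.+-suc (length as) (length bs) ⟨
  length as ℕ.+ suc (length bs)  ≡⟨ List.length-++ as ⟨
  length (as ++ [ x ] ++ bs)     ∎
  where
  open ℕ.≤-Reasoning
  sub′ : ∀ {z} → z ∈ᴸ xs → z ∈ᴸ as ++ bs
  sub′ z∈xs with Mem.∈-++⁻ as (sub (there z∈xs))
  ... | inj₁ z∈as           = Mem.∈-++⁺ˡ z∈as
  ... | inj₂ (here refl)    = contradiction refl (All.lookup x∉ z∈xs)
  ... | inj₂ (there z∈bs)   = Mem.∈-++⁺ʳ as z∈bs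

∑ : {A : Set} → List A → (A → ℕ) → ℕ
∑ xs f = sum (map f xs)

∑-mono : {A : Set} (xs : List A) {f g : A → ℕ} →
  (∀ {x} → x ∈ᴸ xs → f x ≤ g x) → ∑ xs f ≤ ∑ xs g
∑-mono []       f≤g = z≤n
∑-mono (x ∷ xs) f≤g = ℕ.+-mono-≤ (f≤g (here refl)) (∑-mono xs (f≤g ∘ there))

∑-const : {A : Set} (xs : List A) (c : ℕ) → ∑ xs (λ _ → c) ≡ length xs * c
∑-const []       c = refl
∑-const (x ∷ xs) c = cong (c ℕ.+_) (∑-const xs c)

*-∑ : {A : Set} (k : ℕ) (xs : List A) (f : A → ℕ) → k * ∑ xs f ≡ ∑ xs (λ x → k * f x)
*-∑ k []       f = ℕ.*-zeroʳ k
*-∑ k (x ∷ xs) f = trans (ℕ.*-distribˡ-+ k (f x) (∑ xs f)) (cong (k * f x ℕ.+_) (*-∑ k xs f))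

-- Arithmetic of vectors in ℤ^d.

infix 8 -ᵛ_
-ᵛ_ : ∀ {d} → Vec ℤ d → Vec ℤ d
-ᵛ_ = Vec.map (λ i → ℤ.- i)

0ᵛ : ∀ {d} → Vec ℤ d
0ᵛ {d} = Vec.replicate d (+ 0)

+ᵛ-assoc : ∀ {d} (x y z : Vec ℤ d) → (x +ᵛ y) +ᵛ z ≡ x +ᵛ (y +ᵛ z)
+ᵛ-assoc = Vec.zipWith-assoc ℤ.+-assoc

+ᵛ-comm : ∀ {d} (x y : Vec ℤ d) → x +ᵛ y ≡ y +ᵛ x
+ᵛ-comm = Vec.zipWith-comm ℤ.+-comm

-ᵛ-injective : ∀ {d} {x y : Vec ℤ d} → -ᵛ x ≡ -ᵛ y → x ≡ y
-ᵛ-injective {x = []}    {[]}    _ = refl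
-ᵛ-injective {x = _ ∷ _} {_ ∷ _} e =
  cong₂ _∷_ (ℤ.neg-injective (Vec.∷-injectiveˡ e)) (-ᵛ-injective (Vec.∷-injectiveʳ e))

x-z+z≡x : ∀ {d} (x z : Vec ℤ d) → (x +ᵛ -ᵛ z) +ᵛ z ≡ x
x-z+z≡x []      []      = refl
x-z+z≡x (i ∷ x) (j ∷ y) = cong₂ _∷_ (lem i j) (x-z+z≡x x y)
  where
  lem : ∀ i j → (i ℤ.+ ℤ.- j) ℤ.+ j ≡ i
  lem = ℤ-Solver.solve-∀

x+z-z≡x : ∀ {d} (x z : Vec ℤ d) → (x +ᵛ z) +ᵛ -ᵛ z ≡ x
x+z-z≡x []      []      = refl
x+z-z≡x (i ∷ x) (j ∷ y) = cong₂ _∷_ (lem i j) (x+z-z≡x x y)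
  where
  lem : ∀ i j → (i ℤ.+ j) ℤ.+ ℤ.- j ≡ i
  lem = ℤ-Solver.solve-∀

+ᵛ-cancelʳ : ∀ {d} (z : Vec ℤ d) {x y} → x +ᵛ z ≡ y +ᵛ z → x ≡ y
+ᵛ-cancelʳ z {x} {y} e =
  trans (sym (x+z-z≡x x z)) (trans (cong (_+ᵛ -ᵛ z) e) (x+z-z≡x y z))

+ᵛ-cancelˡ : ∀ {d} (z : Vec ℤ d) {x y} → z +ᵛ x ≡ z +ᵛ y → x ≡ y
+ᵛ-cancelˡ z {x} {y} e =
  +ᵛ-cancelʳ z (trans (+ᵛ-comm x z) (trans e (+ᵛ-comm z y)))

x-[y+z] : ∀ {d} (x y z : Vec ℤ d) → x +ᵛ -ᵛ (y +ᵛ z) ≡ (x +ᵛ -ᵛ y) +ᵛ -ᵛ z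
x-[y+z] [] [] [] = refl
x-[y+z] (i ∷ x) (j ∷ y) (k ∷ z) = cong₂ _∷_ (lem i j k) (x-[y+z] x y z)
  where
  lem : ∀ i j k → i ℤ.+ ℤ.- (j ℤ.+ k) ≡ (i ℤ.+ ℤ.- j) ℤ.+ ℤ.- k
  lem = ℤ-Solver.solve-∀

-- Rereads a point of a cube about `x` as a point of a cube about `x +ᵛ u`.
recentre : ∀ {d} (x u r : Vec ℤ d) → x +ᵛ r ≡ (x +ᵛ u) +ᵛ (r +ᵛ -ᵛ u)
recentre [] [] [] = refl
recentre (i ∷ x) (j ∷ y) (k ∷ z) = cong₂ _∷_ (lem i j k) (recentre x y z)
  where
  lem : ∀ i j k → i ℤ.+ k ≡ (i ℤ.+ j) ℤ.+ (k ℤ.+ ℤ.- j)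
  lem = ℤ-Solver.solve-∀

-- Cubes: membership, symmetry and listing without repetition.

∈-interval⇒∣i∣≤ : ∀ n {i} → i ∈ᴸ interval n → ℤ.∣ i ∣ ≤ n
∈-interval⇒∣i∣≤ n i∈ with Mem.∈-map⁻ (λ i → + i ℤ.- + n) i∈
... | j , j∈ , refl = begin
  ℤ.∣ + j ℤ.- + n ∣ ≡⟨ cong ℤ.∣_∣ (ℤ.m-n≡m⊖n j n) ⟩
  ℤ.∣ j ℤ.⊖ n ∣ ≤⟨ bound (ℕ.≤-total n j) ⟩
  n ∎
  where
  open ℕ.≤-Reasoning
  j≤ : j ≤ 2 * n
  j≤ = ℕ.s≤s⁻¹ (Mem.∈-upTo⁻ j∈)
  bound : n ≤ j ⊎ j ≤ n → ℤ.∣ j ℤ.⊖ n ∣ ≤ n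
  bound (inj₁ n≤j) = begin
    ℤ.∣ j ℤ.⊖ n ∣ ≡⟨ cong ℤ.∣_∣ (ℤ.⊖-≥ n≤j) ⟩
    j ℕ.∸ n ≤⟨ ℕ.∸-monoˡ-≤ n j≤ ⟩
    n ℕ.+ (n ℕ.+ 0) ℕ.∸ n ≡⟨ ℕ.m+n∸m≡n n (n ℕ.+ 0) ⟩
    n ℕ.+ 0 ≡⟨ ℕ.+-identityʳ n ⟩
    n ∎
  bound (inj₂ j≤n) = begin
    ℤ.∣ j ℤ.⊖ n ∣ ≡⟨ ℤ.∣⊖∣-≤ j≤n ⟩
    n ℕ.∸ j ≤⟨ ℕ.m∸n≤m n j ⟩
    n ∎

∣i∣≤⇒∈-interval : ∀ n {i} → ℤ.∣ i ∣ ≤ n → i ∈ᴸ interval n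
∣i∣≤⇒∈-interval n {+ k} k≤n = subst (_∈ᴸ interval n) eq
  (Mem.∈-map⁺ (λ i → + i ℤ.- + n) (Mem.∈-upTo⁺ (s≤s (ℕ.+-mono-≤ k≤n (ℕ.≤-reflexive (sym (ℕ.+-identityʳ n)))))))
  where
  eq : + (k ℕ.+ n) ℤ.- + n ≡ + k
  eq = trans (ℤ.+-assoc (+ k) (+ n) (ℤ.- + n))
         (trans (cong (λ t → + k ℤ.+ t) (ℤ.+-inverseʳ (+ n))) (ℤ.+-identityʳ (+ k)))
∣i∣≤⇒∈-interval n { -[1+ k ]} k<n = subst (_∈ᴸ interval n) eq
  (Mem.∈-map⁺ (λ i → + i ℤ.- + n) (Mem.∈-upTo⁺ (s≤s (ℕ.≤-trans (ℕ.m∸n≤m n (suc k)) (ℕ.m≤m+n n (n ℕ.+ 0))))))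
  where
  eq : + (n ℕ.∸ suc k) ℤ.- + n ≡ -[1+ k ]
  eq = trans (ℤ.m-n≡m⊖n (n ℕ.∸ suc k) n)
         (trans (ℤ.⊖-≤ (ℕ.m∸n≤m n (suc k)))
           (cong (λ t → ℤ.- + t) (ℕ.m∸[m∸n]≡n k<n)))

∈-Cube⁻ : ∀ {d n i} {z : Vec ℤ d} → (i ∷ z) ∈ Cube n → ℤ.∣ i ∣ ≤ n × z ∈ Cube n
∈-Cube⁻ {d} {n} iz∈ with Mem.∈-cartesianProductWith⁻ Vec._∷_ (interval n) (cubeList d n) iz∈
... | _ , _ , i∈ , z∈ , refl = ∈-interval⇒∣i∣≤ n i∈ , z∈

∈-Cube⁺ : ∀ {d n i} {z : Vec ℤ d} → ℤ.∣ i ∣ ≤ n → z ∈ Cube n → (i ∷ z) ∈ Cube n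
∈-Cube⁺ {n = n} ∣i∣≤n z∈ = Mem.∈-cartesianProductWith⁺ Vec._∷_ (∣i∣≤⇒∈-interval n ∣i∣≤n) z∈

Cube-+ : ∀ {d m n} {x y : Vec ℤ d} → x ∈ Cube m → y ∈ Cube n → (x +ᵛ y) ∈ Cube (m ℕ.+ n)
Cube-+ {x = []} {[]} _ _ = here refl
Cube-+ {x = i ∷ x} {j ∷ y} ix∈ jy∈ =
  let ∣i∣≤m , x∈ = ∈-Cube⁻ ix∈
      ∣j∣≤n , y∈ = ∈-Cube⁻ jy∈
  in ∈-Cube⁺ (ℕ.≤-trans (ℤ.∣i+j∣≤∣i∣+∣j∣ i j) (ℕ.+-mono-≤ ∣i∣≤m ∣j∣≤n)) (Cube-+ x∈ y∈)

Cube-neg : ∀ {d n} {x : Vec ℤ d} → x ∈ Cube n → (-ᵛ x) ∈ Cube n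
Cube-neg {x = []} _ = here refl
Cube-neg {x = i ∷ x} ix∈ =
  let ∣i∣≤n , x∈ = ∈-Cube⁻ ix∈
  in ∈-Cube⁺ (ℕ.≤-trans (ℕ.≤-reflexive (ℤ.∣-i∣≡∣i∣ i)) ∣i∣≤n) (Cube-neg x∈)

Cube-mono : ∀ {d m n} {x : Vec ℤ d} → m ≤ n → x ∈ Cube m → x ∈ Cube n
Cube-mono {x = []} _ _ = here refl
Cube-mono {x = i ∷ x} m≤n ix∈ =
  let ∣i∣≤m , x∈ = ∈-Cube⁻ ix∈ in ∈-Cube⁺ (ℕ.≤-trans ∣i∣≤m m≤n) (Cube-mono m≤n x∈)

Cube-exhausts : ∀ {d} (x : Vec ℤ d) → ∃[ n ] x ∈ Cube n
Cube-exhausts []      = 0 , here refl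
Cube-exhausts (i ∷ x) =
  let n , x∈ = Cube-exhausts x
  in ℤ.∣ i ∣ ℕ.+ n , ∈-Cube⁺ (ℕ.m≤m+n ℤ.∣ i ∣ n) (Cube-mono (ℕ.m≤n+m n ℤ.∣ i ∣) x∈)

cubeList-unique : ∀ d n → Unique (cubeList d n)
cubeList-unique zero    n = [] ∷ []
cubeList-unique (suc d) n = Unique.cartesianProductWith⁺ Vec._∷_ Vec.∷-injective
  (Unique.map⁺ (λ e → ℤ.+-injective (ℤ-AbelianGroup.∙-cancelʳ (ℤ.- + n) _ _ e)) (Unique.upTo⁺ (suc (2 * n))))
  (cubeList-unique d n)

-- Volumes of cubes and their growth.

Box : ∀ {d} → Vec ℤ d → ℕ → Subset d
Box x n z = ∃[ v ] (v ∈ Cube n × z ≡ x +ᵛ v)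

vol : ℕ → ℕ → ℕ
vol d n = suc (2 * n) ℕ.^ d

vol-nonZero : ∀ d n → ℕ.NonZero (vol d n)
vol-nonZero d n = ℕ.m^n≢0 (suc (2 * n)) d

vol-mono : ∀ d {m n} → m ≤ n → vol d m ≤ vol d n
vol-mono d m≤n = ℕ.^-monoˡ-≤ d (s≤s (ℕ.*-monoʳ-≤ 2 m≤n))

private
  boundary-step : ∀ a h e X Y → (a ℕ.+ h) * (a * Y ℕ.+ e * h * X) ≡
    (a * (a * Y) ℕ.+ e * h * ((a ℕ.+ h) * X)) ℕ.+ h * (a * Y)
  boundary-step = ℕ-Solver.solve-∀

  boundary-step′ : ∀ a h e X Y → (a * (a * Y) ℕ.+ e * h * ((a ℕ.+ h) * X)) ℕ.+ h * ((a ℕ.+ h) * X) ≡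
    a * (a * Y) ℕ.+ suc e * h * ((a ℕ.+ h) * X)
  boundary-step′ = ℕ-Solver.solve-∀

-- Bernoulli's inequality (1 - h/(a+h))^d ≥ 1 - dh/(a+h), cleared of denominators and subtractions.
bernoulli : ∀ d a h → a * (a ℕ.+ h) ℕ.^ d ≤ a * a ℕ.^ d ℕ.+ d * h * (a ℕ.+ h) ℕ.^ d
bernoulli zero    a h = ℕ.m≤m+n _ _
bernoulli (suc d) a h = begin
  a * ((a ℕ.+ h) * X)                                           ≡⟨ ℕ-*.x∙yz≈y∙xz a (a ℕ.+ h) X ⟩
  (a ℕ.+ h) * (a * X)                                           ≤⟨ ℕ.*-monoʳ-≤ (a ℕ.+ h) (bernoulli d a h) ⟩
  (a ℕ.+ h) * (a * Y ℕ.+ d * h * X)                             ≡⟨ boundary-step a h d X Y ⟩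
  (a * (a * Y) ℕ.+ d * h * ((a ℕ.+ h) * X)) ℕ.+ h * (a * Y)      ≤⟨ ℕ.+-monoʳ-≤ (a * (a * Y) ℕ.+ d * h * ((a ℕ.+ h) * X)) (ℕ.*-monoʳ-≤ h (ℕ.^-monoˡ-≤ (suc d) (ℕ.m≤m+n a h))) ⟩
  (a * (a * Y) ℕ.+ d * h * ((a ℕ.+ h) * X)) ℕ.+ h * ((a ℕ.+ h) * X) ≡⟨ boundary-step′ a h d X Y ⟩
  a * (a * Y) ℕ.+ suc d * h * ((a ℕ.+ h) * X)                    ∎
  where
  open ℕ.≤-Reasoning
  X = (a ℕ.+ h) ℕ.^ d
  Y = a ℕ.^ d

-- By `bernoulli` with `h = 2 * c`, the shell of width `c` occupies at most a share d·h/(2n+1) of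
-- the larger cube, and this is at most 1/D from the chosen threshold on.
vol-growth : ∀ d D c → ∃[ N ] (∀ n → N ≤ n → D * vol d (n ℕ.+ c) ≤ D * vol d n ℕ.+ vol d (n ℕ.+ c))
vol-growth d D c = D * (d * h) , bound
  where
  open ℕ.≤-Reasoning
  h = 2 * c
  bound : ∀ n → D * (d * h) ≤ n → D * vol d (n ℕ.+ c) ≤ D * vol d n ℕ.+ vol d (n ℕ.+ c)
  bound n N≤n = subst (λ X → D * X ≤ D * Y ℕ.+ X) X≡ (ℕ.*-cancelˡ-≤ a (begin
    a * (D * X)                         ≡⟨ ℕ-*.x∙yz≈y∙xz a D X ⟩
    D * (a * X)                         ≤⟨ ℕ.*-monoʳ-≤ D (bernoulli d a h) ⟩
    D * (a * Y ℕ.+ d * h * X)           ≡⟨ lem D a Y (d * h) X ⟩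
    a * (D * Y) ℕ.+ (D * (d * h)) * X   ≤⟨ ℕ.+-monoʳ-≤ (a * (D * Y)) (ℕ.*-monoˡ-≤ X N≤a) ⟩
    a * (D * Y) ℕ.+ a * X               ≡⟨ ℕ.*-distribˡ-+ a (D * Y) X ⟨
    a * (D * Y ℕ.+ X)                   ∎))
    where
    a = suc (2 * n)
    X = (a ℕ.+ h) ℕ.^ d
    Y = vol d n
    X≡ : X ≡ vol d (n ℕ.+ c)
    X≡ = cong (λ t → suc t ℕ.^ d) (sym (ℕ.*-distribˡ-+ 2 n c))
    N≤a : D * (d * h) ≤ a
    N≤a = ℕ.≤-trans N≤n (ℕ.≤-trans (ℕ.m≤m+n n (n ℕ.+ 0)) (ℕ.n≤1+n _))
    lem : ∀ D a Y e X → D * (a * Y ℕ.+ e * X) ≡ a * (D * Y) ℕ.+ (D * e) * X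
    lem = ℕ-Solver.solve-∀

-- Inequalities between ratios, in ℕ and in ℚ.

private
  -- c/V ≥ i/(i+1) and V/W ≥ 1 - 1/2D give c/W ≥ 1 - 1/D when 2D ≤ i.
  combine-ratios : ∀ D i c V W → 2 * D ≤ i → i * V ≤ suc i * c → c ≤ W →
    2 * D * W ≤ 2 * D * V ℕ.+ W → D * W ≤ D * c ℕ.+ W
  combine-ratios D i c V W 2D≤i iV≤ c≤W 2DW≤ = ℕ.*-cancelˡ-≤ 2 (begin
    2 * (D * W)                             ≡⟨ ℕ.*-assoc 2 D W ⟨
    2 * D * W                               ≤⟨ 2DW≤ ⟩
    2 * D * V ℕ.+ W                         ≤⟨ ℕ.+-monoˡ-≤ W (ℕ.*-monoʳ-≤ (2 * D) (ℕ.m≤n+m∸n V c)) ⟩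
    2 * D * (c ℕ.+ e) ℕ.+ W                 ≡⟨ cong (ℕ._+ W) (ℕ.*-distribˡ-+ (2 * D) c e) ⟩
    2 * D * c ℕ.+ 2 * D * e ℕ.+ W           ≤⟨ ℕ.+-monoˡ-≤ W (ℕ.+-monoʳ-≤ (2 * D * c) 2De≤W) ⟩
    2 * D * c ℕ.+ W ℕ.+ W                   ≡⟨ lem D c W ⟩
    2 * (D * c ℕ.+ W)                       ∎)
    where
    open ℕ.≤-Reasoning
    e = V ℕ.∸ c
    2De≤W : 2 * D * e ≤ W
    2De≤W = begin
      2 * D * e              ≤⟨ ℕ.*-monoˡ-≤ e 2D≤i ⟩
      i * e                  ≡⟨ ℕ.*-distribˡ-∸ i V c ⟩
      i * V ℕ.∸ i * c        ≤⟨ ℕ.∸-monoˡ-≤ (i * c) iV≤ ⟩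
      c ℕ.+ i * c ℕ.∸ i * c  ≡⟨ ℕ.m+n∸n≡m c (i * c) ⟩
      c                      ≤⟨ c≤W ⟩
      W                      ∎
    lem : ∀ D c W → 2 * D * c ℕ.+ W ℕ.+ W ≡ 2 * (D * c ℕ.+ W)
    lem = ℕ-Solver.solve-∀

  -- Passing to the complements a′ and p′ gives a - p ≤ V - U.
  shell-loss : ∀ D a a′ p p′ z U V → p ℕ.+ p′ ≡ U → a ℕ.+ a′ ≡ V → p′ ≤ a′ →
    D * p ≤ z ℕ.+ 2 * V → D * V ≤ D * U ℕ.+ V → D * a ≤ z ℕ.+ 3 * V
  shell-loss D a a′ p p′ z _ V refl a+a′≡V p′≤a′ Dp≤ DV≤ = ℕ.+-cancelʳ-≤ (D * a′) (D * a) (z ℕ.+ 3 * V) (begin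
    D * a ℕ.+ D * a′               ≡⟨ ℕ.*-distribˡ-+ D a a′ ⟨
    D * (a ℕ.+ a′)                 ≡⟨ cong (D *_) a+a′≡V ⟩
    D * V                          ≤⟨ DV≤ ⟩
    D * (p ℕ.+ p′) ℕ.+ V           ≡⟨ cong (ℕ._+ V) (ℕ.*-distribˡ-+ D p p′) ⟩
    D * p ℕ.+ D * p′ ℕ.+ V         ≤⟨ ℕ.+-monoˡ-≤ V (ℕ.+-mono-≤ Dp≤ (ℕ.*-monoʳ-≤ D p′≤a′)) ⟩
    z ℕ.+ 2 * V ℕ.+ D * a′ ℕ.+ V   ≡⟨ lem z V (D * a′) ⟩
    z ℕ.+ 3 * V ℕ.+ D * a′         ∎)
    where
    open ℕ.≤-Reasoning
    lem : ∀ z V a → z ℕ.+ 2 * V ℕ.+ a ℕ.+ V ≡ z ℕ.+ 3 * V ℕ.+ a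
    lem = ℕ-Solver.solve-∀

  toℚᵘ-/ : ∀ i n → ℚ.toℚᵘ (i ℚ./ suc n) ℚᵘ.≃ ℚᵘ.mkℚᵘ i n
  toℚᵘ-/ i n = ℚ.toℚᵘ-fromℚᵘ (ℚᵘ.mkℚᵘ i n)

archimedean : ∀ c {q} → 0ℚ ℚ.< q → ∃[ D ] (+ c) ℚ./ suc D ℚ.≤ q
archimedean c {ℚ.mkℚ (+ zero)  d _} (ℚ.*<* (ℤ.+<+ ()))
archimedean c {ℚ.mkℚ -[1+ n ]  d _} (ℚ.*<* ())
-- Here q = (n+1)/(d+1), and c/(c(d+1)+1) ≤ 1/(d+1) ≤ q.
archimedean c {ℚ.mkℚ (+ suc n) d _} _ = c * suc d , ℚ.toℚᵘ-cancel-≤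
  (ℚᵘ.≤-respˡ-≃ (ℚᵘ.≃-sym (toℚᵘ-/ (+ c) (c * suc d)))
    (ℚᵘ.*≤* (subst₂ ℤ._≤_ (ℤ.pos-* c (suc d)) (ℤ.pos-* (suc n) (suc (c * suc d)))
      (ℤ.+≤+ (ℕ.≤-trans (ℕ.n≤1+n _) (ℕ.m≤m+n _ _))))))

1/D≤x/V⇒V≤D*x : ∀ D x V .⦃ _ : ℕ.NonZero V ⦄ →
  (+ 1) ℚ./ suc D ℚ.≤ (+ x) ℚ./ V → V ≤ suc D * x
1/D≤x/V⇒V≤D*x D x (suc v) p≤q
  with ℚᵘ.≤-respˡ-≃ (toℚᵘ-/ (+ 1) D) (ℚᵘ.≤-respʳ-≃ (toℚᵘ-/ (+ x) v) (ℚ.toℚᵘ-mono-≤ p≤q))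
... | ℚᵘ.*≤* r = subst₂ _≤_ (ℕ.*-identityˡ (suc v)) (ℕ.*-comm x (suc D))
  (ℤ.drop‿+≤+ (subst₂ ℤ._≤_ (sym (ℤ.pos-* 1 (suc v))) (sym (ℤ.pos-* x (suc D))) r))

-- Carries a counting inequality, cleared of denominators, over to local densities; the final
-- estimate has `c = 3`.
x/V≤y/V+c/D : ∀ c D x y V .⦃ _ : ℕ.NonZero V ⦄ → suc D * x ≤ suc D * y ℕ.+ c * V →
  (+ x) ℚ./ V ℚ.≤ (+ y) ℚ./ V ℚ.+ (+ c) ℚ./ suc D
x/V≤y/V+c/D c D x y (suc v) Dx≤ = ℚ.toℚᵘ-cancel-≤
  (ℚᵘ.≤-respˡ-≃ (ℚᵘ.≃-sym (toℚᵘ-/ (+ x) v))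
  (ℚᵘ.≤-respʳ-≃ (ℚᵘ.≃-sym (ℚᵘ.≃-trans (ℚ.toℚᵘ-homo-+ ((+ y) ℚ./ suc v) ((+ c) ℚ./ suc D))
                             (ℚᵘ.+-cong (toℚᵘ-/ (+ y) v) (toℚᵘ-/ (+ c) D))))
    (ℚᵘ.*≤* (subst₂ ℤ._≤_ (ℤ.pos-* x (suc v * suc D)) eq (ℤ.+≤+ nat≤)))))
  where
  open ℕ.≤-Reasoning
  V = suc v
  nat≤ : x * (V * suc D) ≤ (y * suc D ℕ.+ c * V) * V
  nat≤ = begin
    x * (V * suc D)              ≡⟨ lem x V (suc D) ⟩
    suc D * x * V                ≤⟨ ℕ.*-monoˡ-≤ V Dx≤ ⟩
    (suc D * y ℕ.+ c * V) * V    ≡⟨ cong (λ t → (t ℕ.+ c * V) * V) (ℕ.*-comm (suc D) y) ⟩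
    (y * suc D ℕ.+ c * V) * V    ∎
    where
    lem : ∀ x V D → x * (V * D) ≡ D * x * V
    lem = ℕ-Solver.solve-∀
  eq : + ((y * suc D ℕ.+ c * V) * V) ≡ ((+ y) ℤ.* (+ suc D) ℤ.+ (+ c) ℤ.* (+ V)) ℤ.* (+ V)
  eq = trans (ℤ.pos-* (y * suc D ℕ.+ c * V) V)
         (cong (ℤ._* (+ V)) (trans (ℤ.pos-+ (y * suc D) (c * V))
           (cong₂ ℤ._+_ (ℤ.pos-* y (suc D)) (ℤ.pos-* c V))))

p<q⇒0<q-p : ∀ {p q} → p ℚ.< q → 0ℚ ℚ.< q ℚ.- p
p<q⇒0<q-p {p} {q} p<q = subst (ℚ._< q ℚ.- p) (ℚ.+-inverseʳ p) (ℚ.+-monoˡ-< (ℚ.- p) p<q)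

p<q+r⇒p-r<q : ∀ {p q r} → p ℚ.< q ℚ.+ r → p ℚ.- r ℚ.< q
p<q+r⇒p-r<q {p} {q} {r} p<q+r = subst (p ℚ.- r ℚ.<_)
  (trans (ℚ.+-assoc q r (ℚ.- r)) (trans (cong (q ℚ.+_) (ℚ.+-inverseʳ r)) (ℚ.+-identityʳ q)))
  (ℚ.+-monoˡ-< (ℚ.- r) p<q+r)

0<ʳ⇒positive∈ : ∀ (x : ℝ) → 0ʳ <ʳ x → ∃[ q ] (0ℚ ℚ.< q × q ∈ cut x)
0<ʳ⇒positive∈ x (p , p∈ , p≮0) =
  let q , p<q , q∈ = open-up x p∈ in q , ℚ.≤-<-trans (ℚ.≮⇒≥ p≮0) p<q , q∈

-- Counting points of arbitrary subsets.

module _ (em : ExcludedMiddle 0ℓ) where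

  card : {A : Set} → (A → Set) → List A → ℕ
  card P xs = length (filter (λ x → em {P x}) xs)

  card-map : {A B : Set} (P : B → Set) (f : A → B) (xs : List A) →
    card P (map f xs) ≡ card (P ∘ f) xs
  card-map P f [] = refl
  card-map P f (x ∷ xs) with em {P (f x)}
  ... | yes _ = cong suc (card-map P f xs)
  ... | no  _ = card-map P f xs

  card-swap-∷ : {A B : Set} (R : A → B → Set) (x : A) (xs : List A) (ys : List B) →
    ∑ ys (λ y → card (λ x → R x y) (x ∷ xs)) ≡ card (R x) ys ℕ.+ ∑ ys (λ y → card (λ x → R x y) xs)
  card-swap-∷ R x xs [] = refl
  card-swap-∷ R x xs (y ∷ ys) with em {R x y}
  ... | yes _ = cong suc (trans (cong (card (λ x → R x y) xs ℕ.+_) (card-swap-∷ R x xs ys))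
                           (ℕ-+.x∙yz≈y∙xz (card (λ x → R x y) xs) (card (R x) ys) _))
  ... | no  _ = trans (cong (card (λ x → R x y) xs ℕ.+_) (card-swap-∷ R x xs ys))
                  (ℕ-+.x∙yz≈y∙xz (card (λ x → R x y) xs) (card (R x) ys) _)

  card-swap : {A B : Set} (R : A → B → Set) (xs : List A) (ys : List B) →
    ∑ xs (λ x → card (R x) ys) ≡ ∑ ys (λ y → card (λ x → R x y) xs)
  card-swap R [] ys = sym (trans (∑-const ys 0) (ℕ.*-zeroʳ (length ys)))
  card-swap R (x ∷ xs) ys =
    trans (cong (card (R x) ys ℕ.+_) (card-swap R xs ys)) (sym (card-swap-∷ R x xs ys))

  card-∁ : {A : Set} (P : A → Set) (xs : List A) → card P xs ℕ.+ card (∁ P) xs ≡ length xs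
  card-∁ P [] = refl
  card-∁ P (x ∷ xs) with em {P x} | em {¬ P x}
  ... | yes _ | no _ = cong suc (card-∁ P xs)
  ... | no _ | yes _ = trans (ℕ.+-suc _ _) (cong suc (card-∁ P xs))
  ... | yes p | yes ¬p = contradiction p ¬p
  ... | no ¬p | no ¬¬p = contradiction ¬p ¬¬p

  -- Charging `q` to every entry, including those in `P`, keeps the cardinality of the complement
  -- out of the bound.
  ∑≤card : {A : Set} (P : A → Set) (xs : List A) (f : A → ℕ) (p q : ℕ) →
    (∀ x → P x → f x ≤ p) → (∀ x → ¬ P x → f x ≤ q) →
    ∑ xs f ≤ p * card P xs ℕ.+ q * length xs
  ∑≤card P [] f p q f≤p f≤q = z≤n
  ∑≤card P (x ∷ xs) f p q f≤p f≤q with em {P x} | ∑≤card P xs f p q f≤p f≤q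
  ... | yes Px | ih = begin
    f x ℕ.+ ∑ xs f                                 ≤⟨ ℕ.+-mono-≤ (f≤p x Px) ih ⟩
    p ℕ.+ (p * c ℕ.+ q * l)                        ≤⟨ ℕ.m≤m+n _ q ⟩
    (p ℕ.+ (p * c ℕ.+ q * l)) ℕ.+ q                ≡⟨ lem p q c l ⟩
    p * suc c ℕ.+ q * suc l ∎
    where
    open ℕ.≤-Reasoning
    c = card P xs
    l = length xs
    lem : ∀ p q c l → (p ℕ.+ (p * c ℕ.+ q * l)) ℕ.+ q ≡ p * suc c ℕ.+ q * suc l
    lem = ℕ-Solver.solve-∀
  ... | no ¬Px | ih = begin
    f x ℕ.+ ∑ xs f                                 ≤⟨ ℕ.+-mono-≤ (f≤q x ¬Px) ih ⟩
    q ℕ.+ (p * c ℕ.+ q * l)                        ≡⟨ lem p q c l ⟩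
    p * c ℕ.+ q * suc l ∎
    where
    open ℕ.≤-Reasoning
    c = card P xs
    l = length xs
    lem : ∀ p q c l → q ℕ.+ (p * c ℕ.+ q * l) ≡ p * c ℕ.+ q * suc l
    lem = ℕ-Solver.solve-∀

  length-box : ∀ {d} (x : Vec ℤ d) n → length (map (x +ᵛ_) (cubeList d n)) ≡ vol d n
  length-box {d} x n = trans (List.length-map (x +ᵛ_) (cubeList d n)) (length-cubeList d n)

  count≤vol : ∀ {d} (X : Subset d) x n → count em X x n ≤ vol d n
  count≤vol {d} X x n = ℕ.≤-trans (List.length-filter (λ z → em {z ∈ X}) (map (x +ᵛ_) (cubeList d n))) (ℕ.≤-reflexive (length-box x n))

  -- Boxes are listed without repetition, so the images under `g` are distinct entries of the second
  -- list. Inclusions, translations and reflections of windows are all compared through this.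
  count-injective : ∀ {d} (X Y : Subset d) x y m n (g : Vec ℤ d → Vec ℤ d) →
    (∀ {u v} → g u ≡ g v → u ≡ v) →
    (∀ {z} → z ∈ X → z ∈ Box x m → g z ∈ Y × g z ∈ Box y n) →
    count em X x m ≤ count em Y y n
  count-injective {d} X Y x y m n g g-inj g-maps = begin
    length zs                ≡⟨ List.length-map g zs ⟨
    length (map g zs)        ≤⟨ unique-⊆⇒length≤ (Unique.map⁺ g-inj zs-unique) sub ⟩
    count em Y y n           ∎
    where
    open ℕ.≤-Reasoning
    X? = λ z → em {z ∈ X}
    zs = filter X? (map (x +ᵛ_) (cubeList d m))
    zs-unique : Unique zs
    zs-unique = Unique.filter⁺ X? (Unique.map⁺ (+ᵛ-cancelˡ x) (cubeList-unique d m))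
    sub : ∀ {w} → w ∈ᴸ map g zs → w ∈ᴸ filter (λ z → em {z ∈ Y}) (map (y +ᵛ_) (cubeList d n))
    sub w∈ with Mem.∈-map⁻ g w∈
    ... | z , z∈zs , refl =
      let z∈box , z∈X = Mem.∈-filter⁻ X? {xs = map (x +ᵛ_) (cubeList d m)} z∈zs
          gz∈Y , v , v∈ , gz≡ = g-maps z∈X (Mem.∈-map⁻ (x +ᵛ_) z∈box)
      in Mem.∈-filter⁺ (λ z → em {z ∈ Y})
           (subst (_∈ᴸ map (y +ᵛ_) (cubeList d n)) (sym gz≡) (Mem.∈-map⁺ (y +ᵛ_) v∈)) gz∈Y

  count-∁ : ∀ {d} (X : Subset d) x n → count em X x n ℕ.+ count em (∁ X) x n ≡ vol d n
  count-∁ {d} X x n = trans (card-∁ X (map (x +ᵛ_) (cubeList d n))) (length-box x n)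

  count-mono : ∀ {d} (X : Subset d) x {m n} → m ≤ n → count em X x m ≤ count em X x n
  count-mono X x {m} {n} m≤n = count-injective X X x x m n id id
    λ z∈X (v , v∈ , z≡) → z∈X , v , Cube-mono m≤n v∈ , z≡

  count-empty : ∀ {d} (X : Subset d) x n → (∀ v → v ∈ Cube n → (x +ᵛ v) ∉ X) → count em X x n ≡ 0
  count-empty {d} X x n empty = cong length (List.filter-none (λ z → em {z ∈ X})
    (All.tabulate λ z∈ → let v , v∈ , z≡ = Mem.∈-map⁻ (x +ᵛ_) z∈
                         in λ z∈X → empty v v∈ (subst X z≡ z∈X)))

  -- Double counting of the pairs (y , v) with y + v ∈ X.
  vol*count≤∑count : ∀ {d} (X : Subset d) c M N →
    vol d M * count em X c N ≤ ∑ (map (c +ᵛ_) (cubeList d (N ℕ.+ M))) (λ y → count em X y M)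
  vol*count≤∑count {d} X c M N = begin
    vol d M * count em X c N                        ≡⟨ cong (_* count em X c N) (length-cubeList d M) ⟨
    length (cubeList d M) * count em X c N          ≡⟨ ∑-const (cubeList d M) (count em X c N) ⟨
    ∑ (cubeList d M) (λ v → count em X c N)         ≤⟨ ∑-mono (cubeList d M) translate ⟩
    ∑ (cubeList d M) (λ v → card (λ y → X (y +ᵛ v)) ys) ≡⟨ card-swap (λ y v → X (y +ᵛ v)) ys (cubeList d M) ⟨
    ∑ ys (λ y → card (λ v → X (y +ᵛ v)) (cubeList d M)) ≤⟨ ∑-mono ys (λ {y} _ → ℕ.≤-reflexive (sym (card-map X (y +ᵛ_) (cubeList d M)))) ⟩
    ∑ ys (λ y → count em X y M)                     ∎
    where
    open ℕ.≤-Reasoning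
    ys = map (c +ᵛ_) (cubeList d (N ℕ.+ M))
    translate : ∀ {v} → v ∈ Cube M → count em X c N ≤ card (λ y → X (y +ᵛ v)) ys
    translate {v} v∈ = count-injective X (λ y → X (y +ᵛ v)) c c N (N ℕ.+ M) (_+ᵛ -ᵛ v) (+ᵛ-cancelʳ (-ᵛ v))
      λ {z} z∈X (w , w∈ , z≡) → subst X (sym (x-z+z≡x z v)) z∈X
        , w +ᵛ -ᵛ v , Cube-+ w∈ (Cube-neg v∈)
        , trans (cong (_+ᵛ -ᵛ v) z≡) (+ᵛ-assoc c w (-ᵛ v))

  -- Almost full thickenings of a set of positive density.

  -- Walk upwards from `j` and stop just before the first failure of `P`, which occurs within `r`
  -- steps.
  last-true : (P : ℕ → Set) → ∀ j r → P j → ¬ P (j ℕ.+ r) → ∃[ i ] (j ≤ i × P i × ¬ P (suc i))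
  last-true P j zero    Pj ¬P = contradiction (subst P (sym (ℕ.+-identityʳ j)) Pj) ¬P
  last-true P j (suc r) Pj ¬P with em {P (suc j)}
  ... | no ¬Pj+1 = j , ℕ.≤-refl , Pj , ¬Pj+1
  ... | yes Pj+1 =
    let i , j<i , Pi , ¬Pi+1 = last-true P (suc j) r Pj+1 (¬P ∘ subst P (sym (ℕ.+-suc j r)))
    in i , ℕ.<⇒≤ j<i , Pi , ¬Pi+1

  -- `M` is fixed before `N`: the grid and the index `i` selected in it depend only on `B`, `T` and
  -- `D`, so a single thickening serves arbitrarily large scales.
  dense-thickening : ∀ {d} (B : Subset d) T →
    (∀ N → ∃[ L ] (N ≤ L × ∃[ x ] vol d L ≤ T * count em B x L)) →
    ∀ D → ∃[ M ] (∀ N → ∃[ L ] (N ≤ L × ∃[ x ]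
      D * vol d L ≤ D * count em (B ⊕ Cube M) x L ℕ.+ vol d L))
  dense-thickening {d} B T B-dense D
    with last-true Attained (2 * D) (suc K) attained-2D unattainable
    where
    -- With mesh 1/K the given density 1/T is 2D/K. The search can therefore start at 2D, which
    -- makes i/(i+1) differ from 1 by less than 1/(2D).
    K = 2 * D * T
    Attained : ℕ → Set
    Attained i = ∀ N → ∃[ L ] (N ≤ L × ∃[ x ] i * vol d L ≤ K * count em B x L)

    attained-2D : Attained (2 * D)
    attained-2D N =
      let L , N≤L , x , vol≤ = B-dense N
      in L , N≤L , x , ℕ.≤-trans (ℕ.*-monoʳ-≤ (2 * D) vol≤)
                         (ℕ.≤-reflexive (sym (ℕ.*-assoc (2 * D) T _)))

    -- An index above `K` would mean a density above 1.
    unattainable : ¬ Attained (2 * D ℕ.+ suc K)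
    unattainable att =
      let L , _ , x , ≤K = att 0
          instance _ = vol-nonZero d L
      in ℕ.<-irrefl refl (ℕ.≤-trans (ℕ.m≤n+m (suc K) (2 * D))
           (ℕ.*-cancelʳ-≤ _ K (vol d L) (ℕ.≤-trans ≤K (ℕ.*-monoʳ-≤ K (count≤vol B x L)))))
  ... | i , 2D≤i , attained , ¬attained = M , dense
    where
    open ℕ.≤-Reasoning
    K = 2 * D * T

    bounded-size : ∃[ M ] (∀ x → K * count em B x M ≤ suc i * vol d M)
    bounded-size with em {∃[ M ] (∀ x → K * count em B x M ≤ suc i * vol d M)}
    ... | yes p = p
    -- If no size were bounded, every size `N` would contain a cube witnessing `suc i` at `L = N`,
    -- against the choice of `i`.
    ... | no ¬p = contradiction
      (λ N → N , ℕ.≤-refl , unbounded N) ¬attained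
      where
      unbounded : ∀ N → ∃[ x ] suc i * vol d N ≤ K * count em B x N
      unbounded N with em {∃[ x ] suc i * vol d N ≤ K * count em B x N}
      ... | yes q = q
      ... | no ¬q = contradiction (N , λ x → ℕ.≰⇒≥ λ ≤K → ¬q (x , ≤K)) ¬p

    M = let M , _ = bounded-size in M
    M-bounded = let _ , b = bounded-size in b

    dense : ∀ N → ∃[ L ] (N ≤ L × ∃[ x ]
      D * vol d L ≤ D * count em (B ⊕ Cube M) x L ℕ.+ vol d L)
    dense N with vol-growth d (2 * D) M
    -- Size `N + N₀` meets both the demanded scale and the threshold past which widening by `M`
    -- costs at most a share 1/(2D).
    ... | N₀ , growth with attained (N ℕ.+ N₀)
    ... | L , N+N₀≤L , x , iV≤ =
      L ℕ.+ M , ℕ.≤-trans (ℕ.m+n≤o⇒m≤o N N+N₀≤L) (ℕ.m≤m+n L M) , x ,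
      combine-ratios D i (count em (B ⊕ Cube M) x (L ℕ.+ M)) (vol d L) (vol d (L ℕ.+ M)) 2D≤i
        (ℕ.*-cancelˡ-≤ (vol d M) ⦃ vol-nonZero d M ⦄ (begin
          vol d M * (i * vol d L)                 ≤⟨ ℕ.*-monoʳ-≤ (vol d M) iV≤ ⟩
          vol d M * (K * count em B x L)          ≡⟨ ℕ-*.x∙yz≈y∙xz (vol d M) K _ ⟩
          K * (vol d M * count em B x L)          ≤⟨ ℕ.*-monoʳ-≤ K (vol*count≤∑count B x M L) ⟩
          K * ∑ ys (λ y → count em B y M)         ≡⟨ *-∑ K ys (λ y → count em B y M) ⟩
          -- A window whose centre lies outside `B ⊕ Cube M` misses `B` and contributes 0; every
          -- other window obeys the bound defining `M`.
          ∑ ys (λ y → K * count em B y M)         ≤⟨ ∑≤card (B ⊕ Cube M) ys (λ y → K * count em B y M) (suc i * vol d M) 0 (λ y _ → M-bounded y) away ⟩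
          suc i * vol d M * c ℕ.+ 0               ≡⟨ ℕ.+-identityʳ _ ⟩
          suc i * vol d M * c                     ≡⟨ cong (_* c) (ℕ.*-comm (suc i) (vol d M)) ⟩
          vol d M * suc i * c                     ≡⟨ ℕ.*-assoc (vol d M) (suc i) c ⟩
          vol d M * (suc i * c)                   ∎))
        (count≤vol (B ⊕ Cube M) x (L ℕ.+ M))
        (growth L (ℕ.m+n≤o⇒n≤o N N+N₀≤L))
      where
      ys = map (x +ᵛ_) (cubeList d (L ℕ.+ M))
      c = count em (B ⊕ Cube M) x (L ℕ.+ M)
      away : ∀ y → y ∉ B ⊕ Cube M → K * count em B y M ≤ 0
      away y y∉ = ℕ.≤-reflexive (trans (cong (K *_) (count-empty B y M
        (λ v v∈ y+v∈B → y∉ (y +ᵛ v , -ᵛ v , y+v∈B , Cube-neg v∈ , sym (x+z-z≡x y v)))))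
        (ℕ.*-zeroʳ K))

  -- From rich windows of `A` to cubes in the thickened sumset.

  -- Otherwise b′ ↦ x + b + u - b′ would map B into the complement of A, and there is no room
  -- for that in a cube of size R + k.
  rich⇒⊆⊕ : ∀ {d} (A B : Subset d) D k R x b →
    D * vol d (R ℕ.+ k) ≤ D * count em B b (R ℕ.+ k) ℕ.+ vol d (R ℕ.+ k) →
    vol d (R ℕ.+ k) ℕ.< D * count em A x R →
    ∀ u → u ∈ Cube k → ((x +ᵛ b) +ᵛ u) ∈ A ⊕ B
  rich⇒⊆⊕ {d} A B D k R x b dense rich u u∈ with em {((x +ᵛ b) +ᵛ u) ∈ A ⊕ B}
  ... | yes p = p
  ... | no ¬p = contradiction (ℕ.+-cancelˡ-≤ (D * V) _ _ (begin
    D * V ℕ.+ D * count em A x R                         ≤⟨ ℕ.+-monoˡ-≤ _ dense ⟩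
    D * count em B b L ℕ.+ V ℕ.+ D * count em A x R      ≤⟨ ℕ.+-mono-≤ (ℕ.+-monoˡ-≤ V (ℕ.*-monoʳ-≤ D B≤)) (ℕ.*-monoʳ-≤ D A≤) ⟩
    D * count em (∁ A) c L ℕ.+ V ℕ.+ D * count em A c L  ≡⟨ lem D (count em (∁ A) c L) V (count em A c L) ⟩
    D * (count em A c L ℕ.+ count em (∁ A) c L) ℕ.+ V    ≡⟨ cong (λ t → D * t ℕ.+ V) (count-∁ A c L) ⟩
    D * V ℕ.+ V                                          ∎)) (ℕ.<⇒≱ rich)
    where
    open ℕ.≤-Reasoning
    L = R ℕ.+ k
    V = vol d L
    c = x +ᵛ u
    w = (x +ᵛ b) +ᵛ u

    lem : ∀ D p V q → D * p ℕ.+ V ℕ.+ D * q ≡ D * (q ℕ.+ p) ℕ.+ V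
    lem = ℕ-Solver.solve-∀

    w≡c+b : w ≡ c +ᵛ b
    w≡c+b = trans (+ᵛ-assoc x b u) (trans (cong (x +ᵛ_) (+ᵛ-comm b u)) (sym (+ᵛ-assoc x u b)))

    A≤ : count em A x R ≤ count em A c L
    A≤ = count-injective A A x c R L id id
      λ z∈A (r , r∈ , z≡) → z∈A , r +ᵛ -ᵛ u , Cube-+ r∈ (Cube-neg u∈) , trans z≡ (recentre x u r)

    B≤ : count em B b L ≤ count em (∁ A) c L
    B≤ = count-injective B (∁ A) b c L L (λ y → w +ᵛ -ᵛ y) (-ᵛ-injective ∘ +ᵛ-cancelˡ w)
      λ {y} y∈B (v , v∈ , y≡) →
          (λ w-y∈A → ¬p (w +ᵛ -ᵛ y , y , w-y∈A , y∈B , sym (x-z+z≡x w y)))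
        , -ᵛ v , Cube-neg v∈
        , trans (cong (λ t → w +ᵛ -ᵛ t) y≡) (trans (x-[y+z] w b v)
            (cong (_+ᵛ -ᵛ v) (trans (cong (_+ᵛ -ᵛ b) w≡c+b) (x+z-z≡x c b))))

  module _ {d} (A B : Subset d) (M D k R : ℕ) (b : Vec ℤ d) (s : ℕ) (b∈ : b ∈ Cube s)
    (vol≤2vol : vol d (R ℕ.+ k) ≤ 2 * vol d R)
    (dense-b : D * vol d (R ℕ.+ k) ≤ D * count em (B ⊕ Cube M) b (R ℕ.+ k) ℕ.+ vol d (R ℕ.+ k))
    where

    private
      -- `S` measures `A` at scale `R` against the volume at scale `R + k`, exactly the richness
      -- that `rich⇒⊆⊕` demands.
      S Z : Subset d
      S x = vol d (R ℕ.+ k) ℕ.< D * count em A x R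
      Z z = ∀ u → u ∈ Cube k → z +ᵛ u ∈ (A ⊕ B) ⊕ Cube M

      ⊕-assoc : ∀ {w} → w ∈ A ⊕ (B ⊕ Cube M) → w ∈ (A ⊕ B) ⊕ Cube M
      ⊕-assoc (a , _ , a∈ , (b , v , b∈ , v∈ , refl) , refl) =
        a +ᵛ b , v , (a , b , a∈ , b∈ , refl) , v∈ , sym (+ᵛ-assoc a b v)

      -- Translation by `b` carries `S` into `Z`; enlarging the window by `s` makes room for the
      -- translates.
      S≤Z : ∀ n → count em S 0ᵛ n ≤ count em Z 0ᵛ (n ℕ.+ s)
      S≤Z n = count-injective S Z 0ᵛ 0ᵛ n (n ℕ.+ s) (_+ᵛ b) (+ᵛ-cancelʳ b)
          λ {x} x∈S (v , v∈ , x≡) →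
              (λ u u∈ → ⊕-assoc (rich⇒⊆⊕ A (B ⊕ Cube M) D k R x b dense-b x∈S u u∈))
            , v +ᵛ b , Cube-+ v∈ b∈
            , trans (cong (_+ᵛ b) x≡) (+ᵛ-assoc 0ᵛ v b)

      -- A Markov-type bound: in the average of the windows of size `R`, those centred in `S` hold
      -- at most their full volume, and the others at most vol(R+k)/D ≤ 2·vol(R)/D points of `A`.
      A≤S : ∀ p → D * count em A 0ᵛ p ≤ D * count em S 0ᵛ (p ℕ.+ R) ℕ.+ 2 * vol d (p ℕ.+ R)
      A≤S p = ℕ.*-cancelˡ-≤ (vol d R) ⦃ vol-nonZero d R ⦄ (begin
        vol d R * (D * count em A 0ᵛ p)        ≡⟨ ℕ-*.x∙yz≈y∙xz (vol d R) D (count em A 0ᵛ p) ⟩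
        D * (vol d R * count em A 0ᵛ p)        ≤⟨ ℕ.*-monoʳ-≤ D (vol*count≤∑count A 0ᵛ R p) ⟩
        D * ∑ ys (λ y → count em A y R)        ≡⟨ *-∑ D ys (λ y → count em A y R) ⟩
        ∑ ys (λ y → D * count em A y R)        ≤⟨ ∑≤card S ys (λ y → D * count em A y R) (D * vol d R) (2 * vol d R)
                                                    (λ y _ → ℕ.*-monoʳ-≤ D (count≤vol A y R))
                                                    (λ y y∉S → ℕ.≤-trans (ℕ.≮⇒≥ y∉S) vol≤2vol) ⟩
        D * vol d R * σ ℕ.+ 2 * vol d R * length ys
                                               ≡⟨ cong (λ t → D * vol d R * σ ℕ.+ 2 * vol d R * t) (length-box {d} 0ᵛ (p ℕ.+ R)) ⟩
        D * vol d R * σ ℕ.+ 2 * vol d R * vol d (p ℕ.+ R)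
                                               ≡⟨ lem D (vol d R) σ (vol d (p ℕ.+ R)) ⟩
        vol d R * (D * σ ℕ.+ 2 * vol d (p ℕ.+ R)) ∎)
        where
        open ℕ.≤-Reasoning
        ys = map (0ᵛ +ᵛ_) (cubeList d (p ℕ.+ R))
        σ = count em S 0ᵛ (p ℕ.+ R)
        lem : ∀ D V s W → D * V * s ℕ.+ 2 * V * W ≡ V * (D * s ℕ.+ 2 * W)
        lem = ℕ-Solver.solve-∀

      A≤Z : ∀ p → D * count em A 0ᵛ p ≤ D * count em Z 0ᵛ (p ℕ.+ (R ℕ.+ s)) ℕ.+ 2 * vol d (p ℕ.+ (R ℕ.+ s))
      A≤Z p = ℕ.≤-trans (A≤S p) (ℕ.+-mono-≤
        (ℕ.*-monoʳ-≤ D (subst (λ t → count em S 0ᵛ (p ℕ.+ R) ≤ count em Z 0ᵛ t) (ℕ.+-assoc p R s) (S≤Z (p ℕ.+ R))))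
        (ℕ.*-monoʳ-≤ 2 (vol-mono d (ℕ.+-monoʳ-≤ p (ℕ.m≤m+n R s)))))

    -- `A≤Z` compares cubes of sizes `p` and `n`. The shell between them holds at most a 1/D share
    -- of the larger cube, which raises the loss from 2 to 3 volumes.
    dense-cube⇒count≤ : ∀ p → let n = p ℕ.+ (R ℕ.+ s) in
      D * vol d n ≤ D * vol d p ℕ.+ vol d n →
      D * count em A 0ᵛ n ≤ D * count em Z 0ᵛ n ℕ.+ 3 * vol d n
    dense-cube⇒count≤ p = let n = p ℕ.+ (R ℕ.+ s) in
      shell-loss D (count em A 0ᵛ n) (count em (∁ A) 0ᵛ n) (count em A 0ᵛ p) (count em (∁ A) 0ᵛ p)
        (D * count em Z 0ᵛ n) (vol d p) (vol d n) (count-∁ A 0ᵛ p) (count-∁ A 0ᵛ n)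
        (count-mono (∁ A) 0ᵛ (ℕ.m≤m+n p (R ℕ.+ s))) (A≤Z p)

  count-⊕-thickening : ∀ {d} (A B : Subset d) T →
    (∀ N → ∃[ L ] (N ≤ L × ∃[ x ] vol d L ≤ T * count em B x L)) →
    ∀ D → ∃[ m ] (∀ k → ∃[ N ] (∀ n → N ≤ n →
      D * count em A 0ᵛ n ≤
      D * count em (λ z → ∀ u → u ∈ Cube k → z +ᵛ u ∈ (A ⊕ B) ⊕ Cube m) 0ᵛ n ℕ.+ 3 * vol d n))
  count-⊕-thickening {d} A B T B-dense D =
    -- `M` is chosen before `k`, as syndeticity requires; `L`, `b`, `s` and the threshold may depend
    -- on `k`.
    let M , dense = dense-thickening B T B-dense D in M , λ k →
    let N₂ , growth₂ = vol-growth d 2 k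
        -- Asking for `L ≥ N₂ + k` leaves `R = L ∸ k` at least `N₂`, so that vol(R+k) ≤ 2·vol(R).
        L , N₂+k≤L , b , dense-b = dense (N₂ ℕ.+ k)
        R = L ℕ.∸ k
        R+k≡L = ℕ.m∸n+n≡m (ℕ.m+n≤o⇒n≤o N₂ N₂+k≤L)
        s , b∈ = Cube-exhausts b
        c = R ℕ.+ s
        N , growth = vol-growth d D c
        bound = dense-cube⇒count≤ A B M D k R b s b∈
          (cancel (vol d (R ℕ.+ k)) (vol d R) (growth₂ R (ℕ.m+n≤o⇒m≤o∸n N₂ N₂+k≤L)))
          (subst (λ t → D * vol d t ≤ D * count em (B ⊕ Cube M) b t ℕ.+ vol d t) (sym R+k≡L) dense-b)
    in N ℕ.+ c , λ n N+c≤n →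
      subst (λ t → D * count em A 0ᵛ t ≤
          D * count em (λ z → ∀ u → u ∈ Cube k → z +ᵛ u ∈ (A ⊕ B) ⊕ Cube M) 0ᵛ t ℕ.+ 3 * vol d t)
        (ℕ.m∸n+n≡m (ℕ.m+n≤o⇒n≤o N N+c≤n))
        (bound (n ℕ.∸ c) (growth (n ℕ.∸ c) (ℕ.m+n≤o⇒m≤o∸n N N+c≤n)))
    where
    cancel : ∀ V W → 2 * V ≤ 2 * W ℕ.+ V → V ≤ 2 * W
    cancel V W 2V≤ = ℕ.+-cancelʳ-≤ V V (2 * W)
      (subst (λ t → V ℕ.+ t ≤ 2 * W ℕ.+ V) (ℕ.+-identityʳ V) 2V≤)

  -- From densities as cuts to counts, and back.

  positive-banachDensity : ∀ {d} (B : Subset d) β → IsBanachDensity em B β → 0ʳ <ʳ β →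
    ∃[ T ] (∀ N → ∃[ L ] (N ≤ L × ∃[ x ] vol d L ≤ suc T * count em B x L))
  positive-banachDensity {d} B β BD≡β 0<β =
    let r , 0<r , r∈β = 0<ʳ⇒positive∈ β 0<β
        t , 0<t , t<r = ℚ.<-dense 0<r
        T , 1/T≤t     = archimedean 1 0<t
        -- The tolerance `r - t` is tuned so that, with `r` in the cut of `β`, closeness forces `t`
        -- into the cut of the supremum.
        N₀ , close    = BD≡β (fromℚ (r ℚ.- t)) (0ℚ , p<q⇒0<q-p t<r , ℚ.<-irrefl refl)
    in T , λ N →
    let L = N ℕ.+ N₀
        _ , (e , e<r-t , e∉) = close L (ℕ.m≤n+m N₀ N)
        x , t<δ = decidable-stable (em {t ∈ cut (supDensity em B L)})
                    λ t∉ → e∉ (r , t , r∈β , t∉ , e<r-t)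
    in L , ℕ.m≤m+n N N₀ , x ,
      1/D≤x/V⇒V≤D*x T (count em B x L) (vol d L) ⦃ vol-nonZero d L ⦄ (ℚ.≤-trans 1/T≤t (ℚ.<⇒≤ t<δ))

theorem4p3 : (em : ExcludedMiddle 0ℓ) →
    ∀ (d : ℕ) → 1 ≤ d →
    ∀ (A B : Subset d) (α β : ℝ) →
    lowerDensity em A ≃ʳ α → 0ʳ <ʳ α →
    IsBanachDensity em B β → 0ʳ <ʳ β →
    ∀ (ε : ℝ) → 0ʳ <ʳ ε → ε <ʳ α →
    LowerSyndetic em (α -ʳ ε) (A ⊕ B)
theorem4p3 em d _ A B α β (dA≤α , α≤dA) _ BD≡β 0<β ε 0<ε (p , p∈α , p∉ε) =
  let T , B-dense        = positive-banachDensity em B β BD≡β 0<β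
      e , 0<e , e∈ε      = 0<ʳ⇒positive∈ ε 0<ε
      -- The counting bound loses three volumes out of `suc D`, hence 3/(D+1) in density, which must
      -- fit below `ε`.
      D , 3/D≤e          = archimedean 3 0<e
      m , thick          = count-⊕-thickening em A B (suc T) B-dense (suc D)
  in positive , (λ {q} → ≤1 {q}) , m , λ k _ {q} → syndetic e e∈ε D 3/D≤e _ (thick k) {q}
  where
  positive : 0ʳ <ʳ α -ʳ ε
  -- `p` separates `ε` from `α`; moving up to `r` makes the difference `r - p` strictly positive.
  positive = let r , p<r , r∈α = open-up α p∈α
             in 0ℚ , (r , p , r∈α , p∉ε , p<q⇒0<q-p p<r) , ℚ.<-irrefl refl

  ≤1 : α -ʳ ε ≤ʳ 1ʳ
  ≤1 (a , b , a∈α , b∉ε , q<a-b) =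
    let N , r , a<r , r<     = α≤dA a∈α
        e , 0<e , e∈ε        = 0<ʳ⇒positive∈ ε 0<ε
        a<1 = ℚ.<-≤-trans (ℚ.<-trans a<r (r< 0)) (localDensity≤1 em A 0ᵛ (N ℕ.+ 0))
        0<b = ℚ.<-trans 0<e (∈∉⇒< ε e∈ε b∉ε)
    in ℚ.<-trans q<a-b (p<q+r⇒p-r<q (subst (ℚ._< 1ℚ ℚ.+ b) (ℚ.+-identityʳ a) (ℚ.+-mono-< a<1 0<b)))

  syndetic : ∀ e → e ∈ cut ε → ∀ D → (+ 3) ℚ./ suc D ℚ.≤ e → ∀ (Z : Subset d) →
    ∃[ N ] (∀ n → N ≤ n → suc D * count em A 0ᵛ n ≤ suc D * count em Z 0ᵛ n ℕ.+ 3 * vol d n) →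
    α -ʳ ε ≤ʳ lowerDensity em Z
  syndetic e e∈ε D 3/D≤e Z (N₂ , large) (a , b , a∈α , b∉ε , q<a-b) =
    let N₁ , r , a<r , r< = α≤dA a∈α
    -- The tail infimum needs a common bound strictly above `q`. The number `a - e` is one, since
    -- `e` in the cut of `ε` and `b` outside it give `e < b`; the start `N₁ + N₂` passes both
    -- thresholds.
    in N₁ ℕ.+ N₂ , a ℚ.- e ,
      ℚ.<-trans q<a-b (ℚ.+-monoʳ-< a (ℚ.neg-antimono-< (∈∉⇒< ε e∈ε b∉ε))) ,
      λ i → let n = N₁ ℕ.+ (N₂ ℕ.+ i) in
        subst (λ n → a ℚ.- e ℚ.< localDensity em Z 0ᵛ n) (sym (ℕ.+-assoc N₁ N₂ i))
          (p<q+r⇒p-r<q (ℚ.<-≤-trans (ℚ.<-trans a<r (r< (N₂ ℕ.+ i))) (ℚ.≤-trans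
            (x/V≤y/V+c/D 3 D (count em A 0ᵛ n) (count em Z 0ᵛ n) (vol d n) ⦃ vol-nonZero d n ⦄
              (large n (ℕ.≤-trans (ℕ.m≤m+n N₂ i) (ℕ.m≤n+m (N₂ ℕ.+ i) N₁))))
            (ℚ.+-monoʳ-≤ (localDensity em Z 0ᵛ n) 3/D≤e))))
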